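{- Let $n\ge 1$. For all integers $k\ge 0$ with $k \geq n-3$, the $k$-skeleton of the simplex on vertex set $[n]$ is extendably shellable.
   Context: A simplicial complex on $[n]=\{1,\dots,n\}$ is a collection of subsets (faces) of $[n]$ closed under taking subsets; a face of cardinality $r+1$ has dimension $r$; facets are inclusion-maximal faces; the complex is pure if all facets have the same dimension. The $k$-skeleton of the simplex on $[n]$ consists of all subsets of $[n]$ of dimension at most $k$ (so it is the whole simplex if $k\ge n-1$). A pure $r$-dimensional simplicial complex $\Delta$ is shellable if there is an ordering $F_1,\dots,F_s$ of its facets (a shelling) such that for all $j=2,\dots,s$ the complex $\big(\bigcup_{i=1}^{j-1}F_i\big)\cap F_j$ (the intersection of the complex generated by $F_1,\dots,F_{j-1}$ with the simplex $F_j$) is pure of dimension $r-1$. A subcomplex of a pure complex $\Delta$ here means a simplicial complex on the same vertex set whose set of facets is a subset of the set of facets of $\Delta$. A shellable complex $\Delta$ is extendably shellable if any shelling $F_1,\dots,F_h$ of a subcomplex of $\Delta$ can be extended to a shelling $F_1,\dots,F_h,F_{h+1},\dots,F_s$ of $\Delta$. -}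

module Defs where

open import Data.Fin.Subset using (Subset; _⊆_; ∣_∣)
open import Data.Fin.Subset.Properties using (⊆-trans; p⊆q⇒∣p∣≤∣q∣)
open import Data.Integer using (ℤ; +_; 1ℤ; _-_; _≤_; -_; +≤+)
import Data.Integer.Properties as ℤ
open import Data.List using (List; _∷_; _++_)
open import Data.List.Membership.Propositional using (_∈_)
open import Data.List.Relation.Unary.Any as Any using (Any)
open import Data.List.Relation.Unary.Unique.Propositional using (Unique)
open import Data.Nat using (ℕ)
open import Data.Product using (_×_; _,_; ∃)
open import Function using (_⇔_)
open import Level using (0ℓ)
open import Relation.Binary.PropositionalEquality using (_≡_)
open import Relation.Unary using (Pred)

-- The vertex set [n] is Fin n.  The complex without any faces is allowed,
-- and a vertex need not be a face.
record SimplicialComplex (n : ℕ) : Set₁ where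
  field
    Face   : Pred (Subset n) 0ℓ
    closed : ∀ {S T} → S ⊆ T → Face T → Face S

open SimplicialComplex public

private
  variable
    n : ℕ

-- Integer valued, so that the empty face has dimension -1.
dim : Subset n → ℤ
dim F = + ∣ F ∣ - 1ℤ

Facet : SimplicialComplex n → Pred (Subset n) 0ℓ
Facet Δ F = Face Δ F × (∀ G → Face Δ G → F ⊆ G → F ≡ G)

-- The complex without any faces is pure of every dimension.
PureOfDim : SimplicialComplex n → ℤ → Set
PureOfDim Δ r = ∀ F → Facet Δ F → dim F ≡ r

simplex : Subset n → SimplicialComplex n
simplex F .Face S = S ⊆ F
simplex F .closed S⊆T T⊆F = ⊆-trans S⊆T T⊆F

generated : List (Subset n) → SimplicialComplex n
generated Fs .Face S = Any (λ F → S ⊆ F) Fs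
generated Fs .closed {S} {T} S⊆T =
  Any.map {P = λ F → T ⊆ F} {Q = λ F → S ⊆ F} (λ T⊆F → ⊆-trans S⊆T T⊆F)

infixr 7 _∩_

_∩_ : SimplicialComplex n → SimplicialComplex n → SimplicialComplex n
(Δ ∩ Γ) .Face S = Face Δ S × Face Γ S
(Δ ∩ Γ) .closed S⊆T (T∈Δ , T∈Γ) = closed Δ S⊆T T∈Δ , closed Γ S⊆T T∈Γ

skeleton : (n : ℕ) → ℤ → SimplicialComplex n
skeleton n k .Face S = dim S ≤ k
skeleton n k .closed S⊆T T≤k =
  ℤ.≤-trans (ℤ.+-monoˡ-≤ (- 1ℤ) (+≤+ (p⊆q⇒∣p∣≤∣q∣ S⊆T))) T≤k

record IsShelling (Δ : SimplicialComplex n) (Fs : List (Subset n)) : Set where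
  field
    r      : ℤ
    pure   : PureOfDim Δ r
    unique : Unique Fs
    facets : ∀ F → F ∈ Fs ⇔ Facet Δ F
    -- G ∷ Gs is F₁, …, Fⱼ₋₁ and F is Fⱼ; the prefix is nonempty since j ≥ 2.
    step   : ∀ G Gs F Hs → Fs ≡ (G ∷ Gs) ++ (F ∷ Hs) →
             PureOfDim (generated (G ∷ Gs) ∩ simplex F) (r - 1ℤ)

Shellable : SimplicialComplex n → Set
Shellable Δ = ∃ λ Fs → IsShelling Δ Fs

IsSubcomplex : SimplicialComplex n → SimplicialComplex n → Set
IsSubcomplex Γ Δ = ∀ F → Facet Γ F → Facet Δ F

ExtendablyShellable : SimplicialComplex n → Set₁
ExtendablyShellable Δ =
  Shellable Δ ×
  (∀ Γ → IsSubcomplex Γ Δ → ∀ Fs → IsShelling Γ Fs →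
   ∃ λ Gs → IsShelling Δ (Fs ++ Gs))

{-# OPTIONS --safe #-}
module Submission where

-- When n ≤ k + 2 any ordering of the facets is a shelling, since each new facet
-- is covered by any other one after the removal of a single vertex.
--
-- When n = k + 3 the complements of the facets are the edges of the complete
-- graph on [n], and adding a facet deletes an edge uv from the graph of the
-- edges not used so far.  The step is a shelling step exactly if the common
-- neighbours of u and v form a clique.  Such a deletion keeps the graph chordal,
-- so the graph left over by a partial shelling is chordal.  A chordal graph with
-- an edge has a non-isolated simplicial vertex, and any edge at such a vertex may
-- be deleted next.

open import Defs
open import Data.Nat as ℕ using (ℕ)
open import Data.Integer using (ℤ; +_; 0ℤ; _-_; _≥_)

open import Data.Bool.Properties using () renaming (_≟_ to _≟ᵇ_)
open import Data.Empty using (⊥)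
open import Data.Fin using (Fin; zero; suc; _≟_)
open import Data.Fin.Properties using (any?)
open import Data.Fin.Subset using (Subset; inside; outside; _∈_; _∉_; _⊆_; ∣_∣; ⊤; ⁅_⁆; _∪_)
  renaming (_-_ to _∖_)
open import Data.Fin.Subset.Properties
open import Data.Integer using (1ℤ; _≤_; +≤+; -≤+)
open import Data.List using (List; []; _∷_; _++_; _∷ʳ_; filter; length; allFin; map;
         InitLast; initLast; _∷ʳ′_)
import Data.List.Membership.DecPropositional as ListMembership
open import Data.List.Membership.Propositional using (find; lose)
  renaming (_∈_ to _∈ₗ_; _∉_ to _∉ₗ_)
open import Data.List.Membership.Propositional.Properties
  using (∈-filter⁺; ∈-filter⁻; ∈-++⁺ˡ; ∈-++⁺ʳ; ∈-map⁺; ∈-allFin)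
open import Data.List.Properties using (filter-notAll; ∷ʳ-injective; ++-assoc; ++-identityʳ)
open import Data.List.Relation.Unary.All as All using (All; []; _∷_)
import Data.List.Relation.Unary.All.Properties as All
open import Data.List.Relation.Unary.AllPairs using ([]; _∷_)
open import Data.List.Relation.Unary.Any as Any using (Any; here; there)
open import Data.List.Relation.Unary.Unique.Propositional using (Unique)
import Data.List.Relation.Unary.Unique.Propositional.Properties as Unique
open import Data.Nat using (suc; s≤s; _<_; _⊓_)
open import Data.Nat.Induction using (Acc; acc; <-wellFounded)
import Data.Nat.Properties as ℕ
open import Data.Product using (_×_; _,_; ∃; ∃₂; proj₁; proj₂)
open import Data.Sum using (_⊎_; inj₁; inj₂; [_,_]′)
import Data.Sum as Sum
open import Data.Vec using ([]; _∷_; here; there)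
open import Data.Vec.Properties using (≡-dec)
open import Function using (_∘_; id; Equivalence; mk⇔; _⇔_)
open import Relation.Binary.PropositionalEquality
  using (_≡_; _≢_; refl; sym; trans; cong; subst; ≢-sym)
open import Relation.Nullary using (¬_; Dec; yes; no; ¬?; _×-dec_; _⊎-dec_; contradiction)
open import Relation.Nullary.Decidable using (decidable-stable)

private
  variable
    n m : ℕ
    p q : Subset n
    x y z u v : Fin n

-- Finite subsets and their cardinalities

x∉p∖x : ∀ (p : Subset n) x → x ∉ p ∖ x
x∉p∖x (_ ∷ _) zero    ()
x∉p∖x (_ ∷ p) (suc x) (there x∈) = x∉p∖x p x x∈

x∈p∖y⇒x≢y : x ∈ p ∖ y → x ≢ y
x∈p∖y⇒x≢y {p = p} {y = y} x∈ refl = x∉p∖x p y x∈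

∈∖⇒∈ : ∀ (p : Subset n) y → x ∈ p ∖ y → x ∈ p
∈∖⇒∈ p y = p─q⊆p p _

suc∣p∖x∣≡∣p∣ : x ∈ p → suc ∣ p ∖ x ∣ ≡ ∣ p ∣
suc∣p∖x∣≡∣p∣ {p = _ ∷ p}       here       = cong (suc ∘ ∣_∣) (p─⊥≡p p)
suc∣p∖x∣≡∣p∣ {p = inside ∷ _}  (there x∈) = cong suc (suc∣p∖x∣≡∣p∣ x∈)
suc∣p∖x∣≡∣p∣ {p = outside ∷ _} (there x∈) = suc∣p∖x∣≡∣p∣ x∈

∣p∣<∣q∣⇒∃∈q∉p : ∣ p ∣ < ∣ q ∣ → ∃ λ x → x ∈ q × x ∉ p
∣p∣<∣q∣⇒∃∈q∉p {p = p} {q = q} lt with any? (λ x → x ∈? q ×-dec ¬? (x ∈? p))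
... | yes found = found
... | no  none  = contradiction lt (ℕ.≤⇒≯ (p⊆q⇒∣p∣≤∣q∣ λ {x} x∈q →
                    decidable-stable (x ∈? p) λ x∉p → none (x , x∈q , x∉p)))

p⊆q∧∣q∣≤∣p∣⇒p≡q : p ⊆ q → ∣ q ∣ ℕ.≤ ∣ p ∣ → p ≡ q
p⊆q∧∣q∣≤∣p∣⇒p≡q {p = p} p⊆q le = ⊆-antisym p⊆q λ {x} x∈q →
  decidable-stable (x ∈? p) λ x∉p →
    ℕ.<⇒≱ (p⊂q⇒∣p∣<∣q∣ (p⊆q , x , x∈q , x∉p)) le

_≟ˢ_ : (p q : Subset n) → Dec (p ≡ q)
_≟ˢ_ = ≡-dec _≟ᵇ_

_∈ₗ?_ : (F : Subset n) (Fs : List (Subset n)) → Dec (F ∈ₗ Fs)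
_∈ₗ?_ = ListMembership._∈?_ _≟ˢ_

allSubsets : ∀ n → List (Subset n)
allSubsets ℕ.zero  = [] ∷ []
allSubsets (suc n) = map (inside ∷_) (allSubsets n) ++ map (outside ∷_) (allSubsets n)

∈-allSubsets : (p : Subset n) → p ∈ₗ allSubsets n
∈-allSubsets []            = here refl
∈-allSubsets (inside ∷ p)  = ∈-++⁺ˡ (∈-map⁺ _ (∈-allSubsets p))
∈-allSubsets (outside ∷ p) = ∈-++⁺ʳ _ (∈-map⁺ _ (∈-allSubsets p))

-- Chordal graphs

record Graph (n : ℕ) : Set₁ where
  field
    Adj     : Fin n → Fin n → Set
    adj?    : ∀ x y → Dec (Adj x y)
    adj-sym : Adj x y → Adj y x
    adj⇒≢   : Adj x y → x ≢ y

open Graph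

-- The list `W` stands for the subgraph induced on its entries, so that removing a vertex changes a
-- list and leaves the graph alone. Repeated entries are harmless.
Clique : Graph n → List (Fin n) → Set
Clique Γ W = ∀ {x y} → x ∈ₗ W → y ∈ₗ W → x ≢ y → Adj Γ x y

Simplicial : Graph n → List (Fin n) → Fin n → Set
Simplicial Γ W a = a ∈ₗ W ×
  (∀ {x y} → x ∈ₗ W → y ∈ₗ W → Adj Γ a x → Adj Γ a y → x ≢ y → Adj Γ x y)

-- By Dirac's theorem this is equivalent to the absence of chordless cycles of
-- length at least 4.
Chordal : Graph n → Set
Chordal Γ = ∀ {W w} → w ∈ₗ W → ∃ (Simplicial Γ W)

CommonNeighboursClique : Graph n → Fin n → Fin n → Set
CommonNeighboursClique Γ u v = ∀ {x y} →
  Adj Γ u x → Adj Γ v x → Adj Γ u y → Adj Γ v y → x ≢ y → Adj Γ x y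

clique⇒simplicial : ∀ {Γ : Graph n} {W a} → Clique Γ W → a ∈ₗ W → Simplicial Γ W a
clique⇒simplicial cl a∈W = a∈W , λ x∈W y∈W _ _ → cl x∈W y∈W

clique₃ : ∀ (Γ : Graph n) {x y z} → Adj Γ x y → Adj Γ x z → Adj Γ y z →
          Clique Γ (x ∷ y ∷ z ∷ [])
clique₃ Γ xy xz yz = cl
  where
  cl : Clique Γ _
  cl (here refl)                 (here refl)                 ≢ = contradiction refl ≢
  cl (here refl)                 (there (here refl))         _ = xy
  cl (here refl)                 (there (there (here refl))) _ = xz
  cl (there (here refl))         (here refl)                 _ = adj-sym Γ xy
  cl (there (here refl))         (there (here refl))         ≢ = contradiction refl ≢
  cl (there (here refl))         (there (there (here refl))) _ = yz
  cl (there (there (here refl))) (here refl)                 _ = adj-sym Γ xz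
  cl (there (there (here refl))) (there (here refl))         _ = adj-sym Γ yz
  cl (there (there (here refl))) (there (there (here refl))) ≢ = contradiction refl ≢

remove : Fin n → List (Fin n) → List (Fin n)
remove a = filter (λ x → ¬? (x ≟ a))

∈-remove⁺ : ∀ {a} {W : List (Fin n)} → x ∈ₗ W → x ≢ a → x ∈ₗ remove a W
∈-remove⁺ = ∈-filter⁺ _

∈-remove⁻ : ∀ a {W : List (Fin n)} → x ∈ₗ remove a W → x ∈ₗ W × x ≢ a
∈-remove⁻ a = ∈-filter⁻ (λ x → ¬? (x ≟ a))

length-remove : ∀ {a} {W : List (Fin n)} → a ∈ₗ W → length (remove a W) < length W
length-remove a∈W = filter-notAll _ _ (Any.map (λ a≡x x≢a → x≢a (sym a≡x)) a∈W)

module _ (Γ : Graph n) where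

  -- Putting `a` back gives `b` no new neighbour.
  simplicial-remove : ∀ {W a b} → Simplicial Γ (remove a W) b → ¬ Adj Γ a b → Simplicial Γ W b
  simplicial-remove {W} {a} {b} (b∈ , nb) ¬ab = proj₁ (∈-remove⁻ a b∈) ,
    λ x∈ y∈ bx by → nb (stays x∈ bx) (stays y∈ by) bx by
    where
    stays : x ∈ₗ W → Adj Γ b x → x ∈ₗ remove a W
    stays x∈ bx = ∈-remove⁺ x∈ λ { refl → ¬ab (adj-sym Γ bx) }

  NonadjacentSimplicialPair : List (Fin n) → Set
  NonadjacentSimplicialPair W =
    ∃₂ λ a b → Simplicial Γ W a × Simplicial Γ W b × a ≢ b × ¬ Adj Γ a b

  -- Remove a simplicial vertex `a` and recurse. If the rest has a nonadjacent simplicial pair, `a`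
  -- is not adjacent to both, its neighbours being pairwise adjacent, and it forms a new pair with
  -- one of them. If the rest is a clique, any nonneighbour of `a` in it is a partner for `a`; if
  -- there is none, `W` is a clique.
  dirac : Chordal Γ → ∀ W → Clique Γ W ⊎ NonadjacentSimplicialPair W
  dirac chordal W = go W (<-wellFounded (length W))
    where
    go : ∀ W → Acc _<_ (length W) → Clique Γ W ⊎ NonadjacentSimplicialPair W
    go []        _         = inj₁ λ ()
    go W@(_ ∷ _) (acc rec) = extend-by (chordal {W} (here refl))
      where
      extend-by : ∃ (Simplicial Γ W) → Clique Γ W ⊎ NonadjacentSimplicialPair W
      extend-by (a , a∈W , na) = by-cases (go (remove a W) (rec (length-remove a∈W)))
        where
        pair : ∀ {b} → Simplicial Γ (remove a W) b → ¬ Adj Γ a b → NonadjacentSimplicialPair W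
        pair {b} sb@(b∈ , _) ¬ab =
          a , b , (a∈W , na) , simplicial-remove sb ¬ab , ≢-sym (proj₂ (∈-remove⁻ a {W} b∈)) , ¬ab

        by-cases : Clique Γ (remove a W) ⊎ NonadjacentSimplicialPair (remove a W) →
                   Clique Γ W ⊎ NonadjacentSimplicialPair W
        by-cases (inj₂ (x , y , sx@(x∈ , _) , sy@(y∈ , _) , x≢y , ¬xy)) with adj? Γ a x
        ... | no  ¬ax = inj₂ (pair sx ¬ax)
        ... | yes ax  = inj₂ (pair sy λ ay →
                ¬xy (na (proj₁ (∈-remove⁻ a {W} x∈)) (proj₁ (∈-remove⁻ a {W} y∈)) ax ay x≢y))
        by-cases (inj₁ cl) with Any.any? (¬? ∘ adj? Γ a) (remove a W)
        ... | yes found with b , b∈ , ¬ab ← find found =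
                inj₂ (pair (clique⇒simplicial {Γ = Γ} cl b∈) ¬ab)
        ... | no  none = inj₁ clique
          where
          a~ : y ∈ₗ W → y ≢ a → Adj Γ a y
          a~ {y} y∈ y≢a = decidable-stable (adj? Γ a y) λ ¬ay → none (lose (∈-remove⁺ y∈ y≢a) ¬ay)

          clique : Clique Γ W
          clique {x} {y} x∈ y∈ x≢y with x ≟ a | y ≟ a
          ... | yes refl | _        = a~ y∈ (≢-sym x≢y)
          ... | no  x≢a  | yes refl = adj-sym Γ (a~ x∈ x≢a)
          ... | no  x≢a  | no  y≢a  = cl (∈-remove⁺ x∈ x≢a) (∈-remove⁺ y∈ y≢a) x≢y

  nonIsolated? : ∀ x → Dec (∃ (Adj Γ x))
  nonIsolated? x = any? (adj? Γ x)

  -- Any edge at a simplicial vertex of the subgraph of non-isolated vertices will do.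
  chordal⇒∃commonNeighboursClique : Chordal Γ → Adj Γ x y →
    ∃₂ λ u v → Adj Γ u v × CommonNeighboursClique Γ u v
  chordal⇒∃commonNeighboursClique {x} {y} chordal xy
    -- Isolated vertices are trivially simplicial but offer no edge, so they are left out. No
    -- neighbour of `u` is lost, since it has `u` as a neighbour itself.
    with u , u∈ , nu ← chordal (∈-filter⁺ nonIsolated? (∈-allFin x) (y , xy))
    with v , uv ← proj₂ (∈-filter⁻ nonIsolated? {xs = allFin n} u∈)
    = u , v , uv , λ ux _ uy _ → nu (nonIsolated (adj-sym Γ ux)) (nonIsolated (adj-sym Γ uy)) ux uy
    where
    nonIsolated : ∀ {x y} → Adj Γ x y → x ∈ₗ filter nonIsolated? (allFin n)
    nonIsolated {x} {y} xy = ∈-filter⁺ nonIsolated? (∈-allFin x) (y , xy)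

module _ (Γ Γ′ : Graph n) (u v : Fin n) where

  IsEdgeDeletion : Set
  IsEdgeDeletion =
    (∀ {x y} → Adj Γ′ x y → Adj Γ x y) ×
    (∀ {x y} → Adj Γ x y → Adj Γ′ x y ⊎ (x ≡ u × y ≡ v) ⊎ (x ≡ v × y ≡ u))

  -- A simplicial vertex of Γ stops being simplicial only if it is adjacent to
  -- both u and v, and two nonadjacent vertices cannot both be so.
  deleteEdge-chordal : Chordal Γ → Adj Γ u v → CommonNeighboursClique Γ u v →
                       IsEdgeDeletion → Chordal Γ′
  deleteEdge-chordal chordal uv common (Γ′⊆Γ , kept) {W} w∈ = choose (dirac Γ chordal W)
    where
    survives : ∀ {a} → Simplicial Γ W a →
               Simplicial Γ′ W a ⊎ (u ∈ₗ W × Adj Γ u a × Adj Γ v a)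
    survives {a} (a∈ , na) with Any.any? (u ≟_) W ×-dec adj? Γ u a ×-dec adj? Γ v a
    ... | yes bad = inj₂ bad
    ... | no  ok  = inj₁ (a∈ , nbrs)
      where
      nbrs : ∀ {x y} → x ∈ₗ W → y ∈ₗ W → Adj Γ′ a x → Adj Γ′ a y → x ≢ y → Adj Γ′ x y
      nbrs x∈ y∈ ax ay x≢y with kept (na x∈ y∈ (Γ′⊆Γ ax) (Γ′⊆Γ ay) x≢y)
      ... | inj₁ xy = xy
      ... | inj₂ (inj₁ (refl , refl)) =
              contradiction (x∈ , adj-sym Γ (Γ′⊆Γ ax) , adj-sym Γ (Γ′⊆Γ ay)) ok
      ... | inj₂ (inj₂ (refl , refl)) =
              contradiction (y∈ , adj-sym Γ (Γ′⊆Γ ay) , adj-sym Γ (Γ′⊆Γ ax)) ok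

    choose : Clique Γ W ⊎ NonadjacentSimplicialPair Γ W → ∃ (Simplicial Γ′ W)
    -- If `w` fails, then `u` lies in `W`. As a member of the clique `u` is simplicial too, and it
    -- cannot fail, not being adjacent to itself.
    choose (inj₁ cl) with survives (clique⇒simplicial {Γ = Γ} cl w∈)
    ... | inj₁ sw = _ , sw
    ... | inj₂ (u∈ , _) with survives (clique⇒simplicial {Γ = Γ} cl u∈)
    ...   | inj₁ su = _ , su
    ...   | inj₂ (_ , uu , _) = contradiction refl (adj⇒≢ Γ uu)
    choose (inj₂ (a , b , sa , sb , a≢b , ¬ab)) with survives sa | survives sb
    ... | inj₁ sa′           | _                  = a , sa′
    ... | inj₂ _             | inj₁ sb′           = b , sb′
    ... | inj₂ (_ , ua , va) | inj₂ (_ , ub , vb) = contradiction (common ua va ub vb a≢b) ¬ab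

-- Complements of pairs

record MissesPair (p : Subset n) (x y : Fin n) : Set where
  field
    distinct : x ≢ y
    missesˡ  : x ∉ p
    missesʳ  : y ∉ p
    only     : z ∉ p → z ≡ x ⊎ z ≡ y

open MissesPair

MissesPair-unique : MissesPair p x y → MissesPair q x y → p ≡ q
MissesPair-unique {p = p} {q = q} Mp Mq = ⊆-antisym (included Mp Mq) (included Mq Mp)
  where
  included : ∀ {p q : Subset _} → MissesPair p x y → MissesPair q x y → p ⊆ q
  included {q = q} Mp Mq {z} z∈p = decidable-stable (z ∈? q) λ z∉q →
    [ (λ { refl → missesˡ Mp z∈p }) , (λ { refl → missesʳ Mp z∈p }) ]′ (only Mq z∉q)

1+∣⊤∖x∣≡n : ∀ (x : Fin n) → suc ∣ ⊤ ∖ x ∣ ≡ n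
1+∣⊤∖x∣≡n {n} x = trans (suc∣p∖x∣≡∣p∣ {x = x} ∈⊤) (∣⊤∣≡n n)

2+∣⊤∖x∖y∣≡n : {x y : Fin n} → x ≢ y → 2 ℕ.+ ∣ ⊤ ∖ x ∖ y ∣ ≡ n
2+∣⊤∖x∖y∣≡n {x = x} x≢y =
  trans (cong suc (suc∣p∖x∣≡∣p∣ (x∈p∧x≢y⇒x∈p-y ∈⊤ (≢-sym x≢y)))) (1+∣⊤∖x∣≡n x)

⊤∖x∖y-missesPair : x ≢ y → MissesPair (⊤ ∖ x ∖ y) x y
⊤∖x∖y-missesPair {x = x} {y = y} x≢y = record
  { distinct = x≢y
  ; missesˡ  = x∉p∖x ⊤ x ∘ ∈∖⇒∈ (⊤ ∖ x) y
  ; missesʳ  = x∉p∖x (⊤ ∖ x) y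
  ; only     = λ {z} z∉ → decidable-stable (z ≟ x ⊎-dec z ≟ y) λ neither →
      z∉ (x∈p∧x≢y⇒x∈p-y (x∈p∧x≢y⇒x∈p-y ∈⊤ (neither ∘ inj₁)) (neither ∘ inj₂))
  }

⊆⊤∖x∖y : x ∉ p → y ∉ p → p ⊆ ⊤ ∖ x ∖ y
⊆⊤∖x∖y x∉p y∉p z∈p =
  x∈p∧x≢y⇒x∈p-y (x∈p∧x≢y⇒x∈p-y ∈⊤ λ { refl → x∉p z∈p }) λ { refl → y∉p z∈p }

2+∣p∣≤n : {p : Subset n} {x y : Fin n} → x ≢ y → x ∉ p → y ∉ p → 2 ℕ.+ ∣ p ∣ ℕ.≤ n
2+∣p∣≤n {p = p} x≢y x∉p y∉p = subst (2 ℕ.+ ∣ p ∣ ℕ.≤_) (2+∣⊤∖x∖y∣≡n x≢y)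
  (s≤s (s≤s (p⊆q⇒∣p∣≤∣q∣ (⊆⊤∖x∖y x∉p y∉p))))

-- `p` lies in the complement of the pair, which by the bound is no larger than `p`.
missesPair⁺ : {p : Subset n} {x y : Fin n} → n ℕ.≤ 2 ℕ.+ ∣ p ∣ →
              x ≢ y → x ∉ p → y ∉ p → MissesPair p x y
missesPair⁺ {p = p} {x} {y} le x≢y x∉p y∉p = subst (λ q → MissesPair q x y) (sym p≡) M
  where
  M : MissesPair (⊤ ∖ x ∖ y) x y
  M = ⊤∖x∖y-missesPair x≢y
  p≡ : p ≡ ⊤ ∖ x ∖ y
  p≡ = p⊆q∧∣q∣≤∣p∣⇒p≡q (⊆⊤∖x∖y x∉p y∉p)
    (ℕ.≤-pred (ℕ.≤-pred (subst (ℕ._≤ 2 ℕ.+ ∣ p ∣) (sym (2+∣⊤∖x∖y∣≡n x≢y)) le)))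

∃missesPair : {p : Subset n} → 2 ℕ.+ ∣ p ∣ ≡ n → ∃₂ (MissesPair p)
∃missesPair {n} {p} eq
  with x , _ , x∉p ← ∣p∣<∣q∣⇒∃∈q∉p {p = p} {q = ⊤}
         (subst (∣ p ∣ <_) (trans eq (sym (∣⊤∣≡n n))) (ℕ.m≤n+m _ 1))
  -- Searching in `⊤ ∖ x` makes `y` differ from `x`; this set still has one element more than `p`.
  with y , y∈ , y∉p ← ∣p∣<∣q∣⇒∃∈q∉p {p = p} {q = ⊤ ∖ x}
         (ℕ.≤-reflexive (ℕ.suc-injective (trans eq (sym (1+∣⊤∖x∣≡n x)))))
  = x , y , missesPair⁺ (ℕ.≤-reflexive (sym eq)) (≢-sym (x∈p∖y⇒x≢y y∈)) x∉p y∉p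

-- Shelling steps

-- The dimension comes from `F` and not from an ambient complex, so steps make sense before a
-- complex is given. For empty `Gs` the condition is vacuous.
Step : List (Subset n) → Subset n → Set
Step Gs F = PureOfDim (generated Gs ∩ simplex F) (dim F - 1ℤ)

-- If every common face lies in a common face `F ∖ b`, then a maximal one equals such a ridge.
step⁺ : ∀ {Gs} {F : Subset n} →
  (∀ {S G} → G ∈ₗ Gs → S ⊆ F → S ⊆ G →
     ∃ λ b → b ∈ F × b ∉ S × ∃ λ G′ → G′ ∈ₗ Gs × F ∖ b ⊆ G′) →
  Step Gs F
step⁺ {Gs = Gs} {F} ridge S ((S∈Gs , S⊆F) , maximal)
  with G , G∈ , S⊆G ← find S∈Gs
  with b , b∈F , b∉S , G′ , G′∈ , F∖b⊆G′ ← ridge G∈ S⊆F S⊆G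
  with refl ← maximal (F ∖ b) (lose {P = λ G → F ∖ b ⊆ G} G′∈ F∖b⊆G′ , ∈∖⇒∈ F b)
                (λ x∈S → x∈p∧x≢y⇒x∈p-y (S⊆F x∈S) λ { refl → b∉S x∈S })
  = cong (λ c → + c - 1ℤ - 1ℤ) (suc∣p∖x∣≡∣p∣ b∈F)

-- Each `G` misses at most one vertex. It differs from `F`, so this vertex is some `b` in `F`, and
-- `G` contains `F ∖ b`.
codim1-step : ∀ {Gs} {F : Subset n} → n ℕ.≤ suc ∣ F ∣ →
              All (λ G → ∣ G ∣ ≡ ∣ F ∣) Gs → F ∉ₗ Gs → Step Gs F
codim1-step {n} {Gs} {F} n≤ card F∉Gs = step⁺ ridge
  where
  ridge : ∀ {S G} → G ∈ₗ Gs → S ⊆ F → S ⊆ G →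
          ∃ λ b → b ∈ F × b ∉ S × ∃ λ G′ → G′ ∈ₗ Gs × F ∖ b ⊆ G′
  ridge {S} {G} G∈ _ S⊆G with any? (λ b → b ∈? F ×-dec ¬? (b ∈? G))
  ... | no  none = contradiction (subst (_∈ₗ Gs) (sym F≡G) G∈) F∉Gs
    where
    F≡G : F ≡ G
    F≡G = p⊆q∧∣q∣≤∣p∣⇒p≡q
      (λ {x} x∈F → decidable-stable (x ∈? G) λ x∉G → none (x , x∈F , x∉G))
      (ℕ.≤-reflexive (All.lookup card G∈))
  ... | yes (b , b∈F , b∉G) = b , b∈F , b∉G ∘ S⊆G , G , G∈ , λ {z} z∈ →
    decidable-stable (z ∈? G) λ z∉G →
      ℕ.<⇒≱ (2+∣p∣≤n (x∈p∖y⇒x≢y z∈) z∉G b∉G)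
        (subst (λ c → n ℕ.≤ suc c) (sym (All.lookup card G∈)) n≤)

-- An edge is a pair met by every `G`. If all `G` have `n` minus two elements, these are the pairs
-- whose complement is not yet listed.
uncovered : List (Subset n) → Graph n
uncovered Gs = record
  { Adj     = λ x y → x ≢ y × All (λ G → x ∈ G ⊎ y ∈ G) Gs
  ; adj?    = λ x y → ¬? (x ≟ y) ×-dec All.all? (λ G → x ∈? G ⊎-dec y ∈? G) Gs
  ; adj-sym = λ (x≢y , covers) → ≢-sym x≢y , All.map Sum.swap covers
  ; adj⇒≢   = proj₁
  }

module _ {Gs : List (Subset n)} where

  private
    Γ : Graph n
    Γ = uncovered Gs

  adj⇒¬missed : ∀ {G} → Adj Γ x y → G ∈ₗ Gs → x ∉ G → y ∉ G → ⊥
  adj⇒¬missed (_ , covers) G∈ x∉G y∉G = [ x∉G , y∉G ]′ (All.lookup covers G∈)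

  ¬adj⇒missed : x ≢ y → ¬ Adj Γ x y → ∃ λ G → G ∈ₗ Gs × x ∉ G × y ∉ G
  ¬adj⇒missed {x} {y} x≢y ¬xy
    with G , G∈ , ¬covers ← find (All.¬All⇒Any¬ (λ G → x ∈? G ⊎-dec y ∈? G) Gs (¬xy ∘ (x≢y ,_)))
    = G , G∈ , ¬covers ∘ inj₁ , ¬covers ∘ inj₂

  module _ (card : All (λ G → 2 ℕ.+ ∣ G ∣ ≡ n) Gs) where

    missedPair : ∀ {G} → G ∈ₗ Gs → ∃₂ (MissesPair G)
    missedPair = ∃missesPair ∘ All.lookup card

    missesPair∈ : ∀ {G} → G ∈ₗ Gs → x ≢ y → x ∉ G → y ∉ G → MissesPair G x y
    missesPair∈ = missesPair⁺ ∘ ℕ.≤-reflexive ∘ sym ∘ All.lookup card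

    -- The two vertices missed by `G` are not adjacent.
    clique-⊉-missed : ∀ {G W} → Clique Γ W → G ∈ₗ Gs → ¬ (∀ {z} → z ∉ G → z ∈ₗ W)
    clique-⊉-missed cl G∈ W⊇ =
      let _ , _ , M = missedPair G∈ in
      adj⇒¬missed (cl (W⊇ (missesˡ M)) (W⊇ (missesʳ M)) (distinct M)) G∈ (missesˡ M) (missesʳ M)

    module _ {F : Subset n} (MF : MissesPair F u v) where

      -- A listed `G` that misses both `u` and `v` would be `F`.
      ∉⇒adj : F ∉ₗ Gs → Adj Γ u v
      ∉⇒adj F∉ = distinct MF , All.tabulate λ {G} G∈ →
        decidable-stable (u ∈? G ⊎-dec v ∈? G) λ neither →
          F∉ (subst (_∈ₗ Gs)
            (MissesPair-unique (missesPair∈ G∈ (distinct MF) (neither ∘ inj₁) (neither ∘ inj₂)) MF)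
            G∈)

      -- If the common neighbours `x` and `y` were not adjacent, some `G` would miss exactly these
      -- two. Then `F ∖ x ∖ y` would be a maximal common face, of a dimension too small by one.
      step⇒commonNeighboursClique : Adj Γ u v → Step Gs F → CommonNeighboursClique Γ u v
      step⇒commonNeighboursClique uv pure {x} {y} ux vx uy vy x≢y =
        decidable-stable (adj? Γ x y) contra
        where
        S : Subset n
        S = F ∖ x ∖ y

        common∈F : Adj Γ u z → Adj Γ v z → z ∈ F
        common∈F {z} uz vz = decidable-stable (z ∈? F) λ z∉F →
          [ adj⇒≢ Γ uz ∘ sym , adj⇒≢ Γ vz ∘ sym ]′ (only MF z∉F)

        S⁺ : z ∈ F → z ≢ x → z ≢ y → z ∈ S
        S⁺ z∈F z≢x z≢y = x∈p∧x≢y⇒x∈p-y (x∈p∧x≢y⇒x∈p-y z∈F z≢x) z≢y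

        -- Otherwise G misses two of the pairwise adjacent u, v and w′.
        w∉ : ∀ {w w′ G} → (∀ {z} → z ∈ F → z ≢ w → z ≢ w′ → z ∈ S) →
             Adj Γ u w′ → Adj Γ v w′ → G ∈ₗ Gs → S ⊆ G → w ∉ G
        w∉ {w} {w′} {G} S⁺ uw′ vw′ G∈ S⊆G w∈G =
          clique-⊉-missed (clique₃ Γ uv uw′ vw′) G∈ ∉G⇒
          where
          ∉G⇒ : ∀ {z} → z ∉ G → z ∈ₗ u ∷ v ∷ w′ ∷ []
          ∉G⇒ {z} z∉G with z ∈? F | z ≟ w′
          ... | yes _   | yes z≡w′ = there (there (here z≡w′))
          ... | yes z∈F | no z≢w′  =
                  contradiction (S⊆G (S⁺ z∈F (λ { refl → z∉G w∈G }) z≢w′)) z∉G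
          ... | no z∉F  | _ with only MF z∉F
          ...   | inj₁ z≡u = here z≡u
          ...   | inj₂ z≡v = there (here z≡v)

        2+∣S∣≡∣F∣ : 2 ℕ.+ ∣ S ∣ ≡ ∣ F ∣
        2+∣S∣≡∣F∣ = trans
          (cong suc (suc∣p∖x∣≡∣p∣ (x∈p∧x≢y⇒x∈p-y (common∈F uy vy) (≢-sym x≢y))))
          (suc∣p∖x∣≡∣p∣ (common∈F ux vx))

        s-1≢s : ∀ s → + s - 1ℤ ≢ + s
        s-1≢s ℕ.zero  ()
        s-1≢s (suc s) ()

        contra : ¬ ¬ Adj Γ x y
        contra ¬xy with G , G∈ , x∉G , y∉G ← ¬adj⇒missed x≢y ¬xy =
          -- Since `F` has two vertices more than `S`, purity would make `dim S` equal to `+ ∣ S ∣`.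
          s-1≢s ∣ S ∣ (trans (pure S ((S∈Gs , S⊆F) , maximal))
                             (cong (λ c → + c - 1ℤ - 1ℤ) (sym 2+∣S∣≡∣F∣)))
          where
          S⊆F : S ⊆ F
          S⊆F = ∈∖⇒∈ F x ∘ ∈∖⇒∈ (F ∖ x) y

          S⊆G : S ⊆ G
          S⊆G {z} z∈S = decidable-stable (z ∈? G) λ z∉G →
            [ x∈p∖y⇒x≢y (∈∖⇒∈ (F ∖ x) y z∈S) , x∈p∖y⇒x≢y z∈S ]′
              (only (missesPair∈ G∈ x≢y x∉G y∉G) z∉G)

          S∈Gs : Face (generated Gs) S
          S∈Gs = lose {P = λ G → S ⊆ G} G∈ S⊆G

          maximal : ∀ T → Face (generated Gs ∩ simplex F) T → S ⊆ T → S ≡ T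
          -- `G′` contains `S`, so by `w∉` it avoids `x` and `y`; each of them serves once as the
          -- third vertex of the triangle.
          maximal T (T∈Gs , T⊆F) S⊆T with G′ , G′∈ , T⊆G′ ← find T∈Gs =
            ⊆-antisym S⊆T λ z∈T → S⁺ (T⊆F z∈T)
              (λ { refl → w∉ S⁺ uy vy G′∈ (T⊆G′ ∘ S⊆T) (T⊆G′ z∈T) })
              (λ { refl → w∉ (λ z∈F z≢y z≢x → S⁺ z∈F z≢x z≢y) ux vx G′∈ (T⊆G′ ∘ S⊆T) (T⊆G′ z∈T) })

      -- If `G` misses just one vertex `b` of `F`, it contains `F ∖ b`. If it misses two, they are
      -- not adjacent, so one of them, say `x`, is not adjacent to one of `u` and `v`, say `u`. The
      -- listed set that misses `u` and `x` then contains `F ∖ x`. `G` cannot miss `u` and `v`, as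
      -- `uv` is an edge.
      commonNeighboursClique⇒step : Adj Γ u v → CommonNeighboursClique Γ u v → Step Gs F
      commonNeighboursClique⇒step uv common = step⁺ ridge
        where
        Ridge : Subset n → Set
        Ridge S = ∃ λ b → b ∈ F × b ∉ S × ∃ λ G′ → G′ ∈ₗ Gs × F ∖ b ⊆ G′

        module _ {S} (S⊆F : S ⊆ F) where

          sharing : ∀ {a b G} → a ∉ F → b ∉ S → b ∈ F → G ∈ₗ Gs → a ∉ G → b ∉ G → Ridge S
          sharing {a} {b} {G} a∉F b∉S b∈F G∈ a∉G b∉G = b , b∈F , b∉S , G , G∈ , λ {z} z∈ →
            decidable-stable (z ∈? G) λ z∉G →
              [ (λ { refl → a∉F (∈∖⇒∈ F b z∈) }) , x∈p∖y⇒x≢y z∈ ]′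
                (only (missesPair∈ G∈ (λ { refl → a∉F b∈F }) a∉G b∉G) z∉G)

          nonadjacent : ∀ {a b} → a ∉ F → b ∈ F → b ∉ S → ¬ Adj Γ a b → Ridge S
          nonadjacent a∉F b∈F b∉S ¬ab
            with G , G∈ , a∉G , b∉G ← ¬adj⇒missed (λ { refl → a∉F b∈F }) ¬ab
            = sharing a∉F b∉S b∈F G∈ a∉G b∉G

        ridge : ∀ {S G} → G ∈ₗ Gs → S ⊆ F → S ⊆ G → Ridge S
        ridge {S} {G} G∈ S⊆F S⊆G = by-cases (missedPair G∈)
          where
          disjoint : ∀ {x y} → MissesPair G x y → x ∈ F → y ∈ F → Ridge S
          disjoint {x} {y} MG x∈F y∈F
            with adj? Γ u x | adj? Γ v x | adj? Γ u y | adj? Γ v y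
          ... | no ¬ux | _ | _ | _ = nonadjacent S⊆F (missesˡ MF) x∈F (missesˡ MG ∘ S⊆G) ¬ux
          ... | _ | no ¬vx | _ | _ = nonadjacent S⊆F (missesʳ MF) x∈F (missesˡ MG ∘ S⊆G) ¬vx
          ... | _ | _ | no ¬uy | _ = nonadjacent S⊆F (missesˡ MF) y∈F (missesʳ MG ∘ S⊆G) ¬uy
          ... | _ | _ | _ | no ¬vy = nonadjacent S⊆F (missesʳ MF) y∈F (missesʳ MG ∘ S⊆G) ¬vy
          ... | yes ux | yes vx | yes uy | yes vy =
                  contradiction (missesʳ MG)
                    (adj⇒¬missed (common ux vx uy vy (distinct MG)) G∈ (missesˡ MG))

          equal : ∀ {x y} → MissesPair G x y → x ∉ F → y ∉ F → Ridge S
          equal MG x∉F y∉F with only MF x∉F | only MF y∉F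
          ... | inj₁ refl | inj₁ refl = contradiction refl (distinct MG)
          ... | inj₁ refl | inj₂ refl = contradiction (missesʳ MG) (adj⇒¬missed uv G∈ (missesˡ MG))
          ... | inj₂ refl | inj₁ refl = contradiction (missesˡ MG) (adj⇒¬missed uv G∈ (missesʳ MG))
          ... | inj₂ refl | inj₂ refl = contradiction refl (distinct MG)

          by-cases : ∃₂ (MissesPair G) → Ridge S
          by-cases (x , y , MG) with x ∈? F | y ∈? F
          ... | yes x∈F | yes y∈F = disjoint MG x∈F y∈F
          ... | no x∉F  | no y∉F  = equal MG x∉F y∉F
          ... | no x∉F  | yes y∈F =
                  sharing S⊆F x∉F (missesʳ MG ∘ S⊆G) y∈F G∈ (missesˡ MG) (missesʳ MG)
          ... | yes x∈F | no y∉F  =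
                  sharing S⊆F y∉F (missesˡ MG ∘ S⊆G) x∈F G∈ (missesʳ MG) (missesˡ MG)

-- The missed pair is the only pair that `F` does not meet.
uncovered-∷ʳ : ∀ Gs {F : Subset n} {u v} → MissesPair F u v →
               IsEdgeDeletion (uncovered Gs) (uncovered (Gs ∷ʳ F)) u v
uncovered-∷ʳ Gs {F} {u} {v} MF = (λ (x≢y , covers) → x≢y , All.++⁻ˡ Gs covers) , kept
  where
  kept : ∀ {x y} → Adj (uncovered Gs) x y →
         Adj (uncovered (Gs ∷ʳ F)) x y ⊎ (x ≡ u × y ≡ v) ⊎ (x ≡ v × y ≡ u)
  kept {x} {y} (x≢y , covers) with x ∈? F | y ∈? F
  ... | yes x∈F | _       = inj₁ (x≢y , All.∷ʳ⁺ covers (inj₁ x∈F))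
  ... | no _    | yes y∈F = inj₁ (x≢y , All.∷ʳ⁺ covers (inj₂ y∈F))
  ... | no x∉F  | no y∉F with only MF x∉F | only MF y∉F
  ...   | inj₁ refl | inj₁ refl = contradiction refl x≢y
  ...   | inj₁ x≡u  | inj₂ y≡v  = inj₂ (inj₁ (x≡u , y≡v))
  ...   | inj₂ x≡v  | inj₁ y≡u  = inj₂ (inj₂ (x≡v , y≡u))
  ...   | inj₂ refl | inj₂ refl = contradiction refl x≢y

-- Extending partial shellings

-- A shelling without a complex: only the common cardinality `m` is fixed, so that lists can be
-- extended one set at a time.
record PartialShelling (m : ℕ) (Fs : List (Subset n)) : Set where
  field
    unique : Unique Fs
    card   : All (λ F → ∣ F ∣ ≡ m) Fs
    step   : ∀ G Gs F Hs → Fs ≡ (G ∷ Gs) ++ (F ∷ Hs) → Step (G ∷ Gs) F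

open PartialShelling

[]-partialShelling : PartialShelling {n} m []
[]-partialShelling = record { unique = [] ; card = [] ; step = λ _ _ _ _ () }

Unique-++⇒∉ : ∀ Gs {F : Subset n} {Hs} → Unique (Gs ++ F ∷ Hs) → F ∉ₗ Gs
Unique-++⇒∉ (_ ∷ Gs) (≢s ∷ _) (here refl)   = All.lookup ≢s (∈-++⁺ʳ Gs (here refl)) refl
Unique-++⇒∉ (_ ∷ Gs) (_ ∷ u)  (there F∈Gs) = Unique-++⇒∉ Gs u F∈Gs

∷ʳ-partialShelling : ∀ {Fs} {F : Subset n} → PartialShelling m Fs →
                     ∣ F ∣ ≡ m → F ∉ₗ Fs → Step Fs F → PartialShelling m (Fs ∷ʳ F)
∷ʳ-partialShelling {Fs = Fs} {F} P ∣F∣≡m F∉ stepF = record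
  { unique = Unique.++⁺ (unique P) ([] ∷ []) λ { (F∈ , here refl) → F∉ F∈ }
  ; card   = All.∷ʳ⁺ (card P) ∣F∣≡m
  ; step   = λ G Gs F′ Hs eq → step′ G Gs F′ (initLast Hs) eq
  }
  where
  -- If nothing follows `F′`, it is the new set `F`; otherwise dropping the last entry leaves a
  -- splitting of `Fs`.
  step′ : ∀ G Gs F′ {Hs} → InitLast Hs → Fs ∷ʳ F ≡ (G ∷ Gs) ++ (F′ ∷ Hs) → Step (G ∷ Gs) F′
  step′ G Gs F′ [] eq with refl , refl ← ∷ʳ-injective Fs (G ∷ Gs) eq = stepF
  step′ G Gs F′ (Hs ∷ʳ′ H) eq = step P G Gs F′ Hs
    (proj₁ (∷ʳ-injective Fs _ (trans eq (sym (++-assoc (G ∷ Gs) (F′ ∷ Hs) (H ∷ []))))))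

-- `F` only witnesses that sets are still missing. In codimension two it need not be able to come
-- next, so `F′` may differ from it.
Progress : ℕ → ℕ → Set
Progress n m = ∀ {Fs} {F : Subset n} → PartialShelling m Fs → ∣ F ∣ ≡ m → F ∉ₗ Fs →
  ∃ λ F′ → ∣ F′ ∣ ≡ m × F′ ∉ₗ Fs × Step Fs F′

codim1-progress : n ℕ.≤ suc m → Progress n m
codim1-progress n≤ {F = F} P refl F∉ = F , refl , F∉ , codim1-step n≤ (card P) F∉

uncovered-∷ʳ-chordal : ∀ {Gs} {F : Subset n} → All (λ G → 2 ℕ.+ ∣ G ∣ ≡ n) (Gs ∷ʳ F) →
                       F ∉ₗ Gs → Step Gs F →
                       Chordal (uncovered Gs) → Chordal (uncovered (Gs ∷ʳ F))
uncovered-∷ʳ-chordal {Gs = Gs} {F} card F∉ stepF chordal =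
  let cardG , cardF = All.∷ʳ⁻ card
      u , v , MF = ∃missesPair cardF
      uv = ∉⇒adj cardG MF F∉
  in deleteEdge-chordal (uncovered Gs) (uncovered (Gs ∷ʳ F)) u v chordal uv
       (step⇒commonNeighboursClique cardG MF uv stepF) (uncovered-∷ʳ Gs MF)

partialShelling⇒chordal : ∀ {Fs : List (Subset n)} → 2 ℕ.+ m ≡ n →
                          PartialShelling m Fs → Chordal (uncovered Fs)
partialShelling⇒chordal {n} {m} {Fs} 2+m≡n P =
  -- The start is the complete graph, where every vertex is simplicial.
  go [] Fs refl λ w∈ → _ , clique⇒simplicial {Γ = uncovered []} (λ _ _ x≢y → x≢y , []) w∈
  where
  card-Fs : All (λ G → 2 ℕ.+ ∣ G ∣ ≡ n) Fs
  card-Fs = All.map (λ ∣G∣≡m → trans (cong (2 ℕ.+_) ∣G∣≡m) 2+m≡n) (card P)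

  prefix-step : ∀ Gs {F Hs} → Fs ≡ Gs ++ F ∷ Hs → Step Gs F
  -- The first set carries no condition in `PartialShelling`; no faces are generated before it.
  prefix-step []       _  = λ { _ ((() , _) , _) }
  prefix-step (G ∷ Gs) eq = step P G Gs _ _ eq

  go : ∀ Gs Hs → Fs ≡ Gs ++ Hs → Chordal (uncovered Gs) → Chordal (uncovered Fs)
  go Gs []       eq = subst (λ Gs → Chordal (uncovered Gs)) (sym (trans eq (++-identityʳ Gs)))
  go Gs (F ∷ Hs) eq = go (Gs ∷ʳ F) Hs eq′ ∘ uncovered-∷ʳ-chordal
    (All.++⁻ˡ (Gs ∷ʳ F) (subst (All _) eq′ card-Fs))
    (Unique-++⇒∉ Gs (subst Unique eq (unique P)))
    (prefix-step Gs eq)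
    where
    eq′ : Fs ≡ (Gs ∷ʳ F) ++ Hs
    eq′ = trans eq (sym (++-assoc Gs (F ∷ []) Hs))

-- The missing `F` provides an edge of the uncovered graph. By chordality there is then a deletable
-- edge `uv`, whose complement is the set to add.
codim2-progress : 2 ℕ.+ m ≡ n → Progress n m
codim2-progress {m} {n} 2+m≡n {Fs} {F} P ∣F∣≡m F∉ =
  let _ , _ , MF = ∃missesPair {p = F} (2+card F ∣F∣≡m)
      u , v , uv , common = chordal⇒∃commonNeighboursClique (uncovered Fs)
        (partialShelling⇒chordal 2+m≡n P) (∉⇒adj card-Fs MF F∉)
      MF′ = ⊤∖x∖y-missesPair (proj₁ uv)
  in ⊤ ∖ u ∖ v ,
     ℕ.suc-injective (ℕ.suc-injective (trans (2+∣⊤∖x∖y∣≡n (proj₁ uv)) (sym 2+m≡n))) ,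
     (λ F∈ → adj⇒¬missed uv F∈ (missesˡ MF′) (missesʳ MF′)) ,
     commonNeighboursClique⇒step card-Fs MF′ uv common
  where
  2+card : ∀ (G : Subset n) → ∣ G ∣ ≡ m → 2 ℕ.+ ∣ G ∣ ≡ n
  2+card _ ∣G∣≡m = trans (cong (2 ℕ.+_) ∣G∣≡m) 2+m≡n

  card-Fs : All (λ G → 2 ℕ.+ ∣ G ∣ ≡ n) Fs
  card-Fs = All.map (λ {G} → 2+card G) (card P)

extend : Progress n m → ∀ {Fs} → PartialShelling m Fs →
  ∃ λ Gs → PartialShelling m (Fs ++ Gs) × (∀ (F : Subset n) → ∣ F ∣ ≡ m → F ∈ₗ Fs ++ Gs)
extend {n} {m} progress P =
  go (allSubsets n) (<-wellFounded _) (λ {F} _ _ → ∈-allSubsets F) P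
  where
  go : ∀ {Fs} todo → Acc _<_ (length todo) →
       (∀ {F : Subset n} → ∣ F ∣ ≡ m → F ∉ₗ Fs → F ∈ₗ todo) → PartialShelling m Fs →
       ∃ λ Gs → PartialShelling m (Fs ++ Gs) × (∀ (F : Subset n) → ∣ F ∣ ≡ m → F ∈ₗ Fs ++ Gs)
  go {Fs} todo (acc rec) pending P with anySubset? (λ F → ∣ F ∣ ℕ.≟ m ×-dec ¬? (F ∈ₗ? Fs))
  ... | no none = [] , subst (PartialShelling m) (sym (++-identityʳ _)) P ,
    λ F ∣F∣≡m → ∈-++⁺ˡ (decidable-stable (F ∈ₗ? _) λ F∉ → none (F , ∣F∣≡m , F∉))
  ... | yes (F₀ , ∣F₀∣≡m , F₀∉)
    with F , ∣F∣≡m , F∉ , stepF ← progress P ∣F₀∣≡m F₀∉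
    with Gs , Q , full ← go (filter (λ G → ¬? (G ≟ˢ F)) todo)
           (rec (filter-notAll _ _ (Any.map (λ F≡G G≢F → G≢F (sym F≡G)) (pending ∣F∣≡m F∉))))
           (λ ∣G∣≡m G∉ → ∈-filter⁺ _ (pending ∣G∣≡m (G∉ ∘ ∈-++⁺ˡ))
              λ { refl → G∉ (∈-++⁺ʳ Fs (here refl)) })
           (∷ʳ-partialShelling P ∣F∣≡m F∉ stepF)
    = F ∷ Gs , subst (PartialShelling m) (++-assoc Fs (F ∷ []) Gs) Q ,
      λ G ∣G∣≡m → subst (G ∈ₗ_) (++-assoc Fs (F ∷ []) Gs) (full G ∣G∣≡m)

-- Partial shellings and shellings of complexes

partialShelling⁺ : ∀ {Γ : SimplicialComplex n} {Fs} →
                   (∀ F → Facet Γ F → ∣ F ∣ ≡ m) → IsShelling Γ Fs → PartialShelling m Fs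
partialShelling⁺ {Γ = Γ} {Fs} size sh = record
  { unique = IsShelling.unique sh
  ; card   = All.tabulate λ {F} F∈ → size F (facet F∈)
  -- Purity at the facet `F` identifies the dimension `r` of the shelling with `dim F`.
  ; step   = λ G Gs F Hs eq → subst (λ r → PureOfDim (generated (G ∷ Gs) ∩ simplex F) (r - 1ℤ))
      (sym (IsShelling.pure sh F (facet (subst (F ∈ₗ_) (sym eq) (∈-++⁺ʳ (G ∷ Gs) (here refl))))))
      (IsShelling.step sh G Gs F Hs eq)
  }
  where
  facet : ∀ {F} → F ∈ₗ Fs → Facet Γ F
  facet {F} = Equivalence.to (IsShelling.facets sh F)

partialShelling⇒isShelling : ∀ {Δ : SimplicialComplex n} {Fs} →
  (∀ F → Facet Δ F ⇔ ∣ F ∣ ≡ m) → PartialShelling m Fs → (∀ F → ∣ F ∣ ≡ m → F ∈ₗ Fs) →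
  IsShelling Δ Fs
partialShelling⇒isShelling {m = m} facet⇔ P full = record
  { r      = + m - 1ℤ
  ; pure   = λ F facetF → cong (λ c → + c - 1ℤ) (Equivalence.to (facet⇔ F) facetF)
  ; unique = unique P
  ; facets = λ F → mk⇔ (Equivalence.from (facet⇔ F) ∘ All.lookup (card P))
                       (full F ∘ Equivalence.to (facet⇔ F))
  ; step   = λ G Gs F Hs eq → subst (λ c → PureOfDim (generated (G ∷ Gs) ∩ simplex F) (+ c - 1ℤ - 1ℤ))
      (All.lookup (card P) (subst (F ∈ₗ_) (sym eq) (∈-++⁺ʳ (G ∷ Gs) (here refl))))
      (step P G Gs F Hs eq)
  }

progress⇒extendablyShellable : ∀ {Δ : SimplicialComplex n} →
  (∀ F → Facet Δ F ⇔ ∣ F ∣ ≡ m) → Progress n m → ExtendablyShellable Δ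
progress⇒extendablyShellable {Δ = Δ} facet⇔ progress = shellable , extendable
  where
  shellable : Shellable Δ
  shellable with Gs , P , full ← extend progress []-partialShelling =
    Gs , partialShelling⇒isShelling facet⇔ P full

  extendable : ∀ Γ → IsSubcomplex Γ Δ → ∀ Fs → IsShelling Γ Fs →
               ∃ λ Gs → IsShelling Δ (Fs ++ Gs)
  extendable Γ sub Fs sh
    with Gs , P , full ← extend progress
           (partialShelling⁺ (λ F → Equivalence.to (facet⇔ F) ∘ sub F) sh)
    = Gs , partialShelling⇒isShelling facet⇔ P full

-- Facets of the skeleton

skeleton-face⇔ : ∀ {k} (S : Subset n) → Face (skeleton n (+ k)) S ⇔ ∣ S ∣ ℕ.≤ suc k
skeleton-face⇔ {k = k} S = mk⇔ (to ∣ S ∣) (from ∣ S ∣)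
  where
  to : ∀ s → + s - 1ℤ ≤ + k → s ℕ.≤ suc k
  to ℕ.zero  _         = ℕ.z≤n
  to (suc s) (+≤+ s≤k) = s≤s s≤k
  from : ∀ s → s ℕ.≤ suc k → + s - 1ℤ ≤ + k
  from ℕ.zero  _         = -≤+
  from (suc s) (s≤s s≤k) = +≤+ s≤k

-- The minimum accounts for the whole simplex, whose only facet has `n` vertices. A smaller face is
-- not maximal, because it can take in any vertex outside it.
skeleton-facet⇔ : ∀ {k} (F : Subset n) → Facet (skeleton n (+ k)) F ⇔ ∣ F ∣ ≡ n ⊓ suc k
skeleton-facet⇔ {n} {k} F = mk⇔ to from
  where
  face⇒≤ : ∀ G → Face (skeleton n (+ k)) G → ∣ G ∣ ℕ.≤ n ⊓ suc k
  face⇒≤ G G∈ = ℕ.⊓-glb (∣p∣≤n G) (Equivalence.to (skeleton-face⇔ G) G∈)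

  to : Facet (skeleton n (+ k)) F → ∣ F ∣ ≡ n ⊓ suc k
  to (F∈ , maximal) = decidable-stable (∣ F ∣ ℕ.≟ n ⊓ suc k) λ ≢ → small (ℕ.≤∧≢⇒< (face⇒≤ F F∈) ≢)
    where
    small : ¬ ∣ F ∣ < n ⊓ suc k
    small lt
      with x , _ , x∉F ← ∣p∣<∣q∣⇒∃∈q∉p {p = F} {q = ⊤}
             (subst (∣ F ∣ <_) (sym (∣⊤∣≡n n)) (ℕ.<-≤-trans lt (ℕ.m⊓n≤m n (suc k))))
      = x∉F (subst (x ∈_) (sym F≡) x∈)
      where
      F+x : Subset n
      F+x = F ∪ ⁅ x ⁆
      x∈ : x ∈ F+x
      x∈ = q⊆p∪q F ⁅ x ⁆ (x∈⁅x⁆ x)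
      F+x∖x⊆F : F+x ∖ x ⊆ F
      F+x∖x⊆F z∈ = [ id , (λ z∈x → contradiction (x∈⁅y⁆⇒x≡y x z∈x) (x∈p∖y⇒x≢y z∈)) ]′
        (x∈p∪q⁻ F ⁅ x ⁆ (∈∖⇒∈ F+x x z∈))
      ∣F+x∣≤ : ∣ F+x ∣ ℕ.≤ suc k
      ∣F+x∣≤ = ℕ.≤-trans (subst (ℕ._≤ suc ∣ F ∣) (suc∣p∖x∣≡∣p∣ x∈) (s≤s (p⊆q⇒∣p∣≤∣q∣ F+x∖x⊆F)))
                         (ℕ.≤-trans lt (ℕ.m⊓n≤n n (suc k)))
      F≡ : F ≡ F+x
      F≡ = maximal F+x (Equivalence.from (skeleton-face⇔ F+x) ∣F+x∣≤) (p⊆p∪q ⁅ x ⁆)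

  from : ∣ F ∣ ≡ n ⊓ suc k → Facet (skeleton n (+ k)) F
  from eq = Equivalence.from (skeleton-face⇔ F) (subst (ℕ._≤ suc k) (sym eq) (ℕ.m⊓n≤n n (suc k))) ,
    λ G G∈ F⊆G → p⊆q∧∣q∣≤∣p∣⇒p≡q F⊆G (subst (∣ G ∣ ℕ.≤_) (sym eq) (face⇒≤ G G∈))

-- For `n` at most `k + 2` a facet misses at most one vertex; otherwise `n` is `k + 3` and a facet
-- misses exactly two.
skeleton-progress : ∀ n k → n ℕ.≤ 3 ℕ.+ k → Progress n (n ⊓ suc k)
skeleton-progress n k n≤3+k with n ℕ.≤? 2 ℕ.+ k
... | yes n≤2+k = codim1-progress (ℕ.⊓-glb (ℕ.n≤1+n n) n≤2+k)
... | no  n≰2+k with refl ← ℕ.≤-antisym n≤3+k (ℕ.≰⇒> n≰2+k) =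
  codim2-progress (cong (2 ℕ.+_) (ℕ.m≥n⇒m⊓n≡n (ℕ.m≤n+m (suc k) 2)))

n-3≤k⇒n≤3+k : ∀ n {k} → + n - + 3 ≤ + k → n ℕ.≤ 3 ℕ.+ k
-- Below three the difference is negative and the bound holds for every `k`.
n-3≤k⇒n≤3+k 0                   _         = ℕ.z≤n
n-3≤k⇒n≤3+k 1                   _         = s≤s ℕ.z≤n
n-3≤k⇒n≤3+k 2                   _         = s≤s (s≤s ℕ.z≤n)
n-3≤k⇒n≤3+k (suc (suc (suc n))) (+≤+ n≤k) = s≤s (s≤s (s≤s n≤k))

corollary4p4 : (n : ℕ) → n ℕ.≥ 1 → (k : ℤ) → k ≥ 0ℤ → k ≥ + n - + 3 →
    ExtendablyShellable (skeleton n k)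
corollary4p4 n _ (+ k) _ k≥n-3 =
  progress⇒extendablyShellable skeleton-facet⇔ (skeleton-progress n k (n-3≤k⇒n≤3+k n k≥n-3))
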